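{- Let $k \ge 2$ be an integer, let $U$ be a finite nonempty set, and let $f : \{0,\ldots,k\}^U \to \mathbb{R}_{+}$. Then $f$ is $k$-submodular if and only if $f$ is both submodular in every orthant and pairwise monotone.
   Context: $\mathbb{R}_{+}$ denotes the non-negative reals. For $s,t\in\{0,\ldots,k\}$ define $\mathrm{min}_0(s,t)=0$ if $s\neq 0$, $t\neq 0$ and $s\neq t$, and $\mathrm{min}_0(s,t)=\min(s,t)$ otherwise; define $\mathrm{max}_0(s,t)=0$ if $s\neq 0$, $t\neq 0$ and $s\neq t$, and $\mathrm{max}_0(s,t)=\max(s,t)$ otherwise. Both operations are applied coordinate-wise to vectors in $\{0,\ldots,k\}^U$. $f$ is $k$-submodular if $f(\mathbf{s})+f(\mathbf{t})\ge f(\mathrm{min}_0(\mathbf{s},\mathbf{t}))+f(\mathrm{max}_0(\mathbf{s},\mathbf{t}))$ for all $\mathbf{s},\mathbf{t}\in\{0,\ldots,k\}^U$. Vectors in $\{0,\ldots,k\}^U$ are called partial solutions; an orthant is a vector $\mathbf{x}\in\{1,\ldots,k\}^U$ (no zero coordinate). A partial solution $\mathbf{s}$ is in orthant $\mathbf{x}$ if $s_e\in\{0,x_e\}$ for all $e\in U$. $f$ is submodular in every orthant if for any two partial solutions $\mathbf{a},\mathbf{b}$ lying in a common orthant, $f(\mathbf{a})+f(\mathbf{b})\ge f(\mathrm{min}_0(\mathbf{a},\mathbf{b}))+f(\mathrm{max}_0(\mathbf{a},\mathbf{b}))$. For $e\in U$, $i\in\{1,\ldots,k\}$ and $\mathbf{s}$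 with $s_e=0$, the marginal is $f_{i,e}(\mathbf{s})=f(\mathbf{s}+i\cdot\mathbf{1}_e)-f(\mathbf{s})$, where $\mathbf{1}_e$ is the unit vector of coordinate $e$. $f$ is pairwise monotone (i.e. $2$-wise monotone) if $f_{i,e}(\mathbf{s})+f_{j,e}(\mathbf{s})\ge 0$ for every $e\in U$, every $\mathbf{s}$ with $s_e=0$, and all distinct $i,j\in\{1,\ldots,k\}$. -}

module Defs where

open import Level using (Level; 0ℓ)
open import Data.Bool.Base using (if_then_else_)
open import Data.Fin.Base as Fin using (Fin)
import Data.Fin.Properties as Fin
open import Data.Nat.Base as ℕ using (ℕ; suc)
import Data.Nat.Properties as ℕ
open import Data.Product.Base using (∃; _×_; _,_)
open import Data.Rational as ℚ using (ℚ; 0ℚ; ½; ∣_∣)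
import Data.Rational.Properties as ℚ
open import Data.Rational.Solver using (module +-*-Solver)
open import Data.Sum.Base using (_⊎_)
open import Function.Bundles using (Func; _⟨$⟩_; _↔_)
open import Function.Properties.Inverse using (↔⇒↣)
open import Relation.Binary.Bundles using (Setoid)
open import Relation.Binary.Definitions using (DecidableEquality)
open import Relation.Binary.PropositionalEquality
  using (_≡_; _≢_; refl; sym; trans; cong; subst; _→-setoid_)
open import Relation.Nullary.Decidable using (Dec; does; ¬?; _×-dec_)

import Algebra.Construct.NaturalChoice.Min as Min
import Algebra.Construct.NaturalChoice.Max as Max

private
  variable
    u : Level

-- The reals are Cauchy sequences of rationals, identified when their
-- difference tends to 0 (_≃_).

Eventually : (ℕ → Set) → Set
Eventually P = ∃ λ N → ∀ n → N ℕ.≤ n → P n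

private
  Eventually-map₂ : {P Q R : ℕ → Set} → (∀ {n} → P n → Q n → R n) →
                    Eventually P → Eventually Q → Eventually R
  Eventually-map₂ h (M , p) (N , q) = M ℕ.⊔ N , λ n le →
    h (p n (ℕ.≤-trans (ℕ.m≤m⊔n M N) le)) (q n (ℕ.≤-trans (ℕ.m≤n⊔m M N) le))

  half : ℚ → ℚ
  half ε = ½ ℚ.* ε

  0<half : ∀ {ε} → 0ℚ ℚ.< ε → 0ℚ ℚ.< half ε
  0<half {ε} 0<ε = subst (ℚ._< half ε) (ℚ.*-zeroʳ ½) (ℚ.*-monoʳ-<-pos ½ 0<ε)

  half+half : ∀ ε → half ε ℚ.+ half ε ≡ ε
  half+half ε =
    trans (sym (ℚ.*-distribʳ-+ ε ½ ½)) (ℚ.*-identityˡ ε)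

  ∣-∣-swap : ∀ p q → ∣ p ℚ.- q ∣ ≡ ∣ q ℚ.- p ∣
  ∣-∣-swap p q = trans (sym (ℚ.∣-p∣≡∣p∣ (p ℚ.- q)))
    (cong ∣_∣ (solve 2 (λ p q → :- (p :- q) := q :- p) refl p q))
    where open +-*-Solver

  ∣sum∣≤ : ∀ p q {r ε} → p ℚ.+ q ≡ r →
           ∣ p ∣ ℚ.≤ half ε → ∣ q ∣ ℚ.≤ half ε → ∣ r ∣ ℚ.≤ ε
  ∣sum∣≤ p q {ε = ε} refl p≤ q≤ = ℚ.≤-trans (ℚ.∣p+q∣≤∣p∣+∣q∣ p q)
    (subst (∣ p ∣ ℚ.+ ∣ q ∣ ℚ.≤_) (half+half ε) (ℚ.+-mono-≤ p≤ q≤))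

  ∣-∣-self : ∀ p {ε} → 0ℚ ℚ.< ε → ∣ p ℚ.- p ∣ ℚ.≤ ε
  ∣-∣-self p {ε} 0<ε =
    subst (λ q → ∣ q ∣ ℚ.≤ ε) (sym (ℚ.+-inverseʳ p)) (ℚ.<⇒≤ 0<ε)

IsCauchy : (ℕ → ℚ) → Set
IsCauchy x = ∀ ε → 0ℚ ℚ.< ε →
  ∃ λ N → ∀ m n → N ℕ.≤ m → N ℕ.≤ n → ∣ x m ℚ.- x n ∣ ℚ.≤ ε

record ℝ : Set where
  constructor mkℝ
  field
    seq    : ℕ → ℚ
    cauchy : IsCauchy seq

open ℝ public

infix  4 _≃_ _≤_ _≥_
infixl 6 _+_ _-_
infix  8 -_

_≃_ : ℝ → ℝ → Set
x ≃ y = ∀ ε → 0ℚ ℚ.< ε → Eventually λ n → ∣ seq x n ℚ.- seq y n ∣ ℚ.≤ ε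

_≤_ : ℝ → ℝ → Set
x ≤ y = ∀ ε → 0ℚ ℚ.< ε → Eventually λ n → seq x n ℚ.≤ seq y n ℚ.+ ε

_≥_ : ℝ → ℝ → Set
x ≥ y = y ≤ x

0ℝ : ℝ
0ℝ = mkℝ (λ _ → 0ℚ) (λ ε 0<ε → 0 , λ _ _ _ _ → ∣-∣-self 0ℚ 0<ε)

_+_ : ℝ → ℝ → ℝ
seq    (x + y) n = seq x n ℚ.+ seq y n
cauchy (x + y) ε 0<ε with cauchy x (half ε) (0<half 0<ε)
                        | cauchy y (half ε) (0<half 0<ε)
... | M , p | N , q = M ℕ.⊔ N , λ m n M⊔N≤m M⊔N≤n →
  ∣sum∣≤ (seq x m ℚ.- seq x n) (seq y m ℚ.- seq y n)
    (solve 4 (λ a b c d → (a :- b) :+ (c :- d) := (a :+ c) :- (b :+ d)) refl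
      (seq x m) (seq x n) (seq y m) (seq y n))
    (p m n (ℕ.m⊔n≤o⇒m≤o M N M⊔N≤m) (ℕ.m⊔n≤o⇒m≤o M N M⊔N≤n))
    (q m n (ℕ.m⊔n≤o⇒n≤o M N M⊔N≤m) (ℕ.m⊔n≤o⇒n≤o M N M⊔N≤n))
  where open +-*-Solver

-_ : ℝ → ℝ
seq    (- x) n = ℚ.- seq x n
cauchy (- x) ε 0<ε with cauchy x ε 0<ε
... | N , p = N , λ m n N≤m N≤n →
  subst (λ q → ∣ q ∣ ℚ.≤ ε)
    (solve 2 (λ a b → b :- a := (:- a) :- (:- b)) refl (seq x m) (seq x n))
    (p n m N≤n N≤m)
  where open +-*-Solver

_-_ : ℝ → ℝ → ℝ
x - y = x + (- y)

ℝ-setoid : Setoid 0ℓ 0ℓ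
ℝ-setoid = record
  { Carrier       = ℝ
  ; _≈_           = _≃_
  ; isEquivalence = record
    { refl  = λ {x} ε 0<ε → 0 , λ n _ → ∣-∣-self (seq x n) 0<ε
    ; sym   = λ {x} {y} x≃y ε 0<ε → let N , p = x≃y ε 0<ε in N , λ n N≤n →
        subst (ℚ._≤ ε) (∣-∣-swap (seq x n) (seq y n)) (p n N≤n)
    ; trans = λ {x} {y} {z} x≃y y≃z ε 0<ε →
        Eventually-map₂ (λ {n} → ∣sum∣≤ (seq x n ℚ.- seq y n) (seq y n ℚ.- seq z n)
            (solve 3 (λ a b c → (a :- b) :+ (b :- c) := a :- c) refl
              (seq x n) (seq y n) (seq z n)))
          (x≃y (half ε) (0<half 0<ε)) (y≃z (half ε) (0<half 0<ε))
    }
  }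
  where open +-*-Solver

Finite : Set u → Set u
Finite U = ∃ λ n → U ↔ Fin n

Finite⇒≟ : {U : Set u} → Finite U → DecidableEquality U
Finite⇒≟ (_ , U↔Fin) = Fin.inj⇒≟ (↔⇒↣ U↔Fin)

-- {0,…,k} is Fin (suc k), and {1,…,k} consists of its nonzero elements.

module _ {k : ℕ} where

  open Min (Fin.≤-totalOrder (suc k)) using (_⊓_)
  open Max (Fin.≤-totalOrder (suc k)) using (_⊔_)

  Conflict : Fin (suc k) → Fin (suc k) → Set
  Conflict s t = s ≢ Fin.zero × t ≢ Fin.zero × s ≢ t

  conflict? : ∀ s t → Dec (Conflict s t)
  conflict? s t = ¬? (s Fin.≟ Fin.zero) ×-dec ¬? (t Fin.≟ Fin.zero) ×-dec ¬? (s Fin.≟ t)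

  min₀ : Fin (suc k) → Fin (suc k) → Fin (suc k)
  min₀ s t = if does (conflict? s t) then Fin.zero else s ⊓ t

  max₀ : Fin (suc k) → Fin (suc k) → Fin (suc k)
  max₀ s t = if does (conflict? s t) then Fin.zero else s ⊔ t

PartialSolution : ℕ → Set u → Set u
PartialSolution k U = U → Fin (suc k)

-- Without function extensionality, vectors indexed by U are identified when
-- they agree at every coordinate, and a real function on {0,…,k}^U is a map
-- of setoids.
RealFunction : ℕ → Set u → Set u
RealFunction k U = Func (U →-setoid Fin (suc k)) ℝ-setoid

module _ {k : ℕ} {U : Set u} where

  Min₀ Max₀ : PartialSolution k U → PartialSolution k U → PartialSolution k U
  Min₀ s t e = min₀ (s e) (t e)
  Max₀ s t e = max₀ (s e) (t e)

  SubmodularAt : RealFunction k U → PartialSolution k U → PartialSolution k U → Set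
  SubmodularAt f s t =
    (f ⟨$⟩ s) + (f ⟨$⟩ t) ≥ (f ⟨$⟩ Min₀ s t) + (f ⟨$⟩ Max₀ s t)

  KSubmodular : RealFunction k U → Set u
  KSubmodular f = ∀ s t → SubmodularAt f s t

  IsOrthant : PartialSolution k U → Set u
  IsOrthant x = ∀ e → x e ≢ Fin.zero

  _InOrthant_ : PartialSolution k U → PartialSolution k U → Set u
  s InOrthant x = ∀ e → s e ≡ Fin.zero ⊎ s e ≡ x e

  SubmodularInEveryOrthant : RealFunction k U → Set u
  SubmodularInEveryOrthant f =
    ∀ x → IsOrthant x → ∀ a b → a InOrthant x → b InOrthant x → SubmodularAt f a b

  module _ (_≟_ : DecidableEquality U) where

    -- Only used when s e is zero, where it is s + i · 1ₑ.
    set : PartialSolution k U → U → Fin (suc k) → PartialSolution k U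
    set s e i e′ = if does (e′ ≟ e) then i else s e′

    marginal : RealFunction k U → Fin (suc k) → U → PartialSolution k U → ℝ
    marginal f i e s = (f ⟨$⟩ set s e i) - (f ⟨$⟩ s)

    PairwiseMonotone : RealFunction k U → Set u
    PairwiseMonotone f =
      ∀ e s → s e ≡ Fin.zero →
      ∀ i j → i ≢ Fin.zero → j ≢ Fin.zero → i ≢ j →
      marginal f i e s + marginal f j e s ≥ 0ℝ

{-# OPTIONS --safe #-}

-- For the converse, write m = Min₀ s t and M = Max₀ s t.  No coordinate of s or
-- of t conflicts with M, so submodularity in orthants applies to (s , M), to
-- (t , M) and to (Min₀ s M , Min₀ t M), and the three inequalities reduce the
-- claim to f a + f b ≥ 2 f M for a = Max₀ s M and b = Max₀ t M.  Here a and b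
-- are equal or in conflict at every coordinate, and Min₀ a b = M.  For such
-- pairs induct on the set of conflicts: at a conflict e let a₀ be a with
-- coordinate e erased, h be a with coordinate e replaced by that of b, and
-- d = Min₀ h b.  Then
--   f a + f h ≥ 2 f a₀         by pairwise monotonicity,
--   f h + f b ≥ 2 f d          by induction,
--   f a₀ + f d ≥ f M + f h     in an orthant,
-- and adding the last one twice to the others gives f a + f b ≥ 2 f M.
module Submission where

open import Defs
open import Data.Empty using (⊥-elim)
open import Data.Fin.Base as Fin using (Fin; zero; suc)
import Data.Fin.Properties as Fin
open import Data.List.Base using (List; []; _∷_; map; allFin)
open import Data.List.Membership.Propositional using (_∈_)
open import Data.List.Membership.Propositional.Properties using (∈-map⁺; ∈-allFin)
open import Data.List.Relation.Unary.Any using (here; there)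
open import Data.List.Relation.Unary.Any.Properties using (¬Any[])
open import Data.Nat.Base as ℕ using (ℕ; suc)
import Data.Nat.Properties as ℕ
open import Data.Product.Base using (∃; _×_; _,_)
open import Data.Rational as ℚ using (0ℚ; ½)
import Data.Rational.Properties as ℚ
open import Data.Rational.Solver using (module +-*-Solver)
open import Data.Sum.Base using (_⊎_; inj₁; inj₂)
open import Function.Base using (_∘_)
open import Function.Bundles using (Func; _⟨$⟩_; _⇔_; mk⇔; Inverse)
open import Relation.Binary.Definitions using (DecidableEquality)
open import Relation.Binary.PropositionalEquality
  using (_≡_; _≢_; _≗_; refl; sym; trans; cong; cong₂; subst; subst₂)
open import Relation.Nullary.Decidable using (yes; no; dec-true; dec-false)
open import Relation.Nullary.Negation using (¬_)

import Algebra.Construct.NaturalChoice.Min as Min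
import Algebra.Construct.NaturalChoice.Max as Max

open +-*-Solver using (solve; _:=_; _:+_; _:-_; con)

-- Order and addition on the reals.

+-mono-≤ : ∀ {x y z w} → x ≤ y → z ≤ w → x + z ≤ y + w
+-mono-≤ {x} {y} {z} {w} x≤y z≤w ε 0<ε =
  let δ = ½ ℚ.* ε
      0<δ = subst (ℚ._< δ) (ℚ.*-zeroʳ ½) (ℚ.*-monoʳ-<-pos ½ 0<ε)
      M , p = x≤y δ 0<δ
      N , q = z≤w δ 0<δ
  in M ℕ.⊔ N , λ n le → subst (seq (x + z) n ℚ.≤_)
       (solve 3 (λ a b e → (a :+ con ½ :* e) :+ (b :+ con ½ :* e) := (a :+ b) :+ e) refl
         (seq y n) (seq w n) ε)
       (ℚ.+-mono-≤ (p n (ℕ.m⊔n≤o⇒m≤o M N le)) (q n (ℕ.m⊔n≤o⇒n≤o M N le)))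
  where open +-*-Solver using (_:*_)

≃⇒≤ : ∀ {x y} → x ≃ y → x ≤ y
≃⇒≤ {x} {y} x≃y ε 0<ε = let N , p = x≃y ε 0<ε in N , λ n N≤n →
  subst₂ ℚ._≤_
    (solve 2 (λ a b → b :+ (a :- b) := a) refl (seq x n) (seq y n)) refl
    (ℚ.+-monoʳ-≤ (seq y n)
      (ℚ.≤-trans (p≤∣p∣ (seq x n ℚ.- seq y n)) (p n N≤n)))
  where
  p≤∣p∣ : ∀ p → p ℚ.≤ ℚ.∣ p ∣
  p≤∣p∣ p with ℚ.≤-total 0ℚ p
  ... | inj₁ 0≤p = ℚ.≤-reflexive (sym (ℚ.0≤p⇒∣p∣≡p 0≤p))
  ... | inj₂ p≤0 = ℚ.≤-trans p≤0 (ℚ.0≤∣p∣ p)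

-- The hypothesis says y′ − x′ = y − x termwise; with +-mono-≤ this derives any
-- nonnegative integer combination of inequalities.
≤-shift : ∀ {x y} x′ y′ → x ≤ y →
          (∀ n → seq x′ n ℚ.+ seq y n ≡ seq y′ n ℚ.+ seq x n) → x′ ≤ y′
≤-shift {x} {y} x′ y′ x≤y eq ε 0<ε = let N , p = x≤y ε 0<ε in N , λ n N≤n →
  subst₂ ℚ._≤_
    (solve 2 (λ a b → (a :- b) :+ b := a) refl (seq x′ n) (seq x n))
    (trans
      (solve 4 (λ a b c e → (a :- b) :+ (c :+ e) := ((a :+ c) :- b) :+ e) refl
        (seq x′ n) (seq x n) (seq y n) ε)
      (trans (cong (λ q → (q ℚ.- seq x n) ℚ.+ ε) (eq n))
        (solve 3 (λ a b e → ((a :+ b) :- b) :+ e := a :+ e) refl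
          (seq y′ n) (seq x n) ε)))
    (ℚ.+-monoʳ-≤ (seq x′ n ℚ.- seq x n) (p n N≤n))

-- Adding the hypotheses gives `x + y ≤ y + z`, and `≤-shift` cancels `y`.
≤-trans : ∀ {x y z} → x ≤ y → y ≤ z → x ≤ z
≤-trans {x} {y} {z} x≤y y≤z =
  ≤-shift {x + y} {y + z} x z (+-mono-≤ {x} {y} {y} {z} x≤y y≤z) λ n →
    solve 3 (λ a b c → a :+ (b :+ c) := c :+ (a :+ b)) refl (seq x n) (seq y n) (seq z n)

-- Single-coordinate identities for `min₀` and `max₀`.

module _ {k : ℕ} where

  open Min (Fin.≤-totalOrder (suc k)) using (⊓-idem)
  open Max (Fin.≤-totalOrder (suc k)) using (⊔-idem)

  private
    variable
      s t : Fin (suc k)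

  min₀-conflict : Conflict s t → min₀ s t ≡ zero
  min₀-conflict {s} {t} c rewrite dec-true (conflict? s t) c = refl

  max₀-conflict : Conflict s t → max₀ s t ≡ zero
  max₀-conflict {s} {t} c rewrite dec-true (conflict? s t) c = refl

  ¬conflict-self : ¬ Conflict s s
  ¬conflict-self (_ , _ , s≢s) = s≢s refl

  min₀-idem : (s : Fin (suc k)) → min₀ s s ≡ s
  min₀-idem s rewrite dec-false (conflict? s s) ¬conflict-self = ⊓-idem s

  max₀-idem : (s : Fin (suc k)) → max₀ s s ≡ s
  max₀-idem s rewrite dec-false (conflict? s s) ¬conflict-self = ⊔-idem s

  min₀-zeroʳ : (s : Fin (suc k)) → min₀ s zero ≡ zero
  min₀-zeroʳ zero = refl
  min₀-zeroʳ (suc s) = refl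

  max₀-zeroˡ : (t : Fin (suc k)) → max₀ zero t ≡ t
  max₀-zeroˡ zero = refl
  max₀-zeroˡ (suc t) = refl

  max₀-zeroʳ : (s : Fin (suc k)) → max₀ s zero ≡ s
  max₀-zeroʳ zero = refl
  max₀-zeroʳ (suc s) = refl

  -- Comparison s t m M means m = min₀ s t and M = max₀ s t.
  data Comparison : (s t m M : Fin (suc k)) → Set where
    zeroˡ : Comparison zero t zero t
    zeroʳ : Comparison s zero zero s
    same  : Comparison s s s s
    clash : Conflict s t → Comparison s t zero zero

  -- Matching on the result replaces both operations by explicit values, so later identities are
  -- checked in four cases.
  compare₀ : ∀ s t → Comparison s t (min₀ s t) (max₀ s t)
  compare₀ zero zero = zeroˡ
  compare₀ zero (suc _) = zeroˡ
  compare₀ (suc _) zero = zeroʳ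
  compare₀ s@(suc _) t@(suc _) with s Fin.≟ t
  ... | yes refl = subst₂ (Comparison s s) (sym (min₀-idem s)) (sym (max₀-idem s)) same
  ... | no s≢t = subst₂ (Comparison s t) (sym (min₀-conflict c)) (sym (max₀-conflict c)) (clash c)
    where
    c : Conflict s t
    c = (λ ()) , (λ ()) , s≢t

  ¬conflict-zeroˡ : ¬ Conflict zero t
  ¬conflict-zeroˡ (0≢0 , _) = 0≢0 refl

  ¬conflict-zeroʳ : ¬ Conflict s zero
  ¬conflict-zeroʳ (_ , 0≢0 , _) = 0≢0 refl

  module _ {s t m M : Fin (suc k)} where

    ¬conflict-max₀ˡ : Comparison s t m M → ¬ Conflict s M
    ¬conflict-max₀ˡ zeroˡ = ¬conflict-zeroˡ
    ¬conflict-max₀ˡ zeroʳ = ¬conflict-self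
    ¬conflict-max₀ˡ same = ¬conflict-self
    ¬conflict-max₀ˡ (clash _) = ¬conflict-zeroʳ

    ¬conflict-max₀ʳ : Comparison s t m M → ¬ Conflict t M
    ¬conflict-max₀ʳ zeroˡ = ¬conflict-self
    ¬conflict-max₀ʳ zeroʳ = ¬conflict-zeroˡ
    ¬conflict-max₀ʳ same = ¬conflict-self
    ¬conflict-max₀ʳ (clash _) = ¬conflict-zeroʳ

    -- `min₀ s M` is `s` with a clash erased: zero where `s` and `t` conflict, since `M` is zero
    -- there, and `s` otherwise. The same holds for `t`. Erasing clashes this way changes neither
    -- the minimum nor the maximum of the pair, which gives the next two lemmas.
    ¬conflict-min₀-max₀ : Comparison s t m M → ¬ Conflict (min₀ s M) (min₀ t M)
    ¬conflict-min₀-max₀ zeroˡ = ¬conflict-zeroˡ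
    ¬conflict-min₀-max₀ zeroʳ = ¬conflict-zeroʳ
    ¬conflict-min₀-max₀ same = ¬conflict-self
    ¬conflict-min₀-max₀ (clash _) (min≢0 , _) = min≢0 (min₀-zeroʳ s)

    min₀-min₀-max₀ : Comparison s t m M → min₀ (min₀ s M) (min₀ t M) ≡ m
    min₀-min₀-max₀ zeroˡ = refl
    min₀-min₀-max₀ zeroʳ = min₀-zeroʳ (min₀ s s)
    min₀-min₀-max₀ same = trans (min₀-idem (min₀ s s)) (min₀-idem s)
    min₀-min₀-max₀ (clash _) = cong₂ min₀ (min₀-zeroʳ s) (min₀-zeroʳ t)

    max₀-min₀-max₀ : Comparison s t m M → max₀ (min₀ s M) (min₀ t M) ≡ M
    max₀-min₀-max₀ zeroˡ = trans (max₀-zeroˡ (min₀ t t)) (min₀-idem t)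
    max₀-min₀-max₀ zeroʳ = trans (max₀-zeroʳ (min₀ s s)) (min₀-idem s)
    max₀-min₀-max₀ same = trans (max₀-idem (min₀ s s)) (min₀-idem s)
    max₀-min₀-max₀ (clash _) = cong₂ max₀ (min₀-zeroʳ s) (min₀-zeroʳ t)

    -- `max₀ s M` is `s` at a clash, because `M` vanishes there, and `M` otherwise; likewise for
    -- `t`.
    max₀-max₀-≡⊎conflict : Comparison s t m M →
                           max₀ s M ≡ max₀ t M ⊎ Conflict (max₀ s M) (max₀ t M)
    max₀-max₀-≡⊎conflict zeroˡ = inj₁ (trans (max₀-zeroˡ t) (sym (max₀-idem t)))
    max₀-max₀-≡⊎conflict zeroʳ = inj₁ (trans (max₀-idem s) (sym (max₀-zeroˡ s)))
    max₀-max₀-≡⊎conflict same = inj₁ refl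
    max₀-max₀-≡⊎conflict (clash c) =
      inj₂ (subst₂ Conflict (sym (max₀-zeroʳ s)) (sym (max₀-zeroʳ t)) c)

    min₀-max₀-max₀ : Comparison s t m M → min₀ (max₀ s M) (max₀ t M) ≡ M
    min₀-max₀-max₀ zeroˡ = trans (cong₂ min₀ (max₀-zeroˡ t) (max₀-idem t)) (min₀-idem t)
    min₀-max₀-max₀ zeroʳ = trans (cong₂ min₀ (max₀-idem s) (max₀-zeroˡ s)) (min₀-idem s)
    min₀-max₀-max₀ same = trans (min₀-idem (max₀ s s)) (max₀-idem s)
    min₀-max₀-max₀ (clash c) =
      trans (cong₂ min₀ (max₀-zeroʳ s) (max₀-zeroʳ t)) (min₀-conflict c)

  module _ {s t : Fin (suc k)} where

    -- Under either alternative `min₀ s t` is `s` or zero. This serves the coordinates other than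
    -- `e` in the inductive step of `opposed-≥`.
    ¬conflict-min₀ : s ≡ t ⊎ Conflict s t → ¬ Conflict s (min₀ s t)
    ¬conflict-min₀ (inj₁ refl) (_ , _ , s≢min) = s≢min (sym (min₀-idem s))
    ¬conflict-min₀ (inj₂ c) (_ , min≢0 , _) = min≢0 (min₀-conflict c)

    min₀-min₀ : s ≡ t ⊎ Conflict s t → min₀ s (min₀ s t) ≡ min₀ s t
    min₀-min₀ (inj₁ refl) = cong (min₀ s) (min₀-idem s)
    min₀-min₀ (inj₂ c) =
      trans (cong (min₀ s) (min₀-conflict c)) (trans (min₀-zeroʳ s) (sym (min₀-conflict c)))

    max₀-min₀ : s ≡ t ⊎ Conflict s t → max₀ s (min₀ s t) ≡ s
    max₀-min₀ (inj₁ refl) = trans (cong (max₀ s) (min₀-idem s)) (max₀-idem s)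
    max₀-min₀ (inj₂ c) = trans (cong (max₀ s) (min₀-conflict c)) (max₀-zeroʳ s)

-- Common orthants.

commonValue : ∀ {k} → Fin (suc (suc k)) → Fin (suc (suc k)) → Fin (suc (suc k))
-- An orthant has no zero coordinate, so where both vectors vanish an arbitrary nonzero value is
-- chosen.
commonValue zero zero = suc zero
commonValue zero t@(suc _) = t
commonValue s@(suc _) _ = s

commonValue≢0 : ∀ {k} (s t : Fin (suc (suc k))) → commonValue s t ≢ zero
commonValue≢0 zero zero ()
commonValue≢0 zero (suc _) ()
commonValue≢0 (suc _) _ ()

commonValue-left : ∀ {k} (s t : Fin (suc (suc k))) → s ≡ zero ⊎ s ≡ commonValue s t
commonValue-left zero _ = inj₁ refl
commonValue-left (suc _) _ = inj₂ refl

commonValue-right : ∀ {k} (s t : Fin (suc (suc k))) → ¬ Conflict s t →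
                    t ≡ zero ⊎ t ≡ commonValue s t
commonValue-right _ zero _ = inj₁ refl
commonValue-right zero (suc _) _ = inj₂ refl
commonValue-right s@(suc _) t@(suc _) ¬c with s Fin.≟ t
... | yes s≡t = inj₂ (sym s≡t)
... | no s≢t = ⊥-elim (¬c ((λ ()) , (λ ()) , s≢t))

module _ {u} {U : Set u} {k : ℕ} (f : RealFunction (suc k) U)
         (sub : SubmodularInEveryOrthant f) where

  -- Without conflicts at most one nonzero value occurs at each coordinate, and `commonValue` picks
  -- it, so both vectors lie in the orthant it defines.
  submodular-compatible : ∀ s t → (∀ e → ¬ Conflict (s e) (t e)) → SubmodularAt f s t
  submodular-compatible s t compatible = sub
    (λ e → commonValue (s e) (t e)) (λ e → commonValue≢0 (s e) (t e)) s t
    (λ e → commonValue-left (s e) (t e))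
    (λ e → commonValue-right (s e) (t e) (compatible e))

-- Invariance under pointwise equality, and necessity of pairwise monotonicity.

module _ {u} {U : Set u} {k : ℕ} (f : RealFunction k U) where

  -- `Min₀ s t` and `Max₀ s t` are usually only pointwise equal to the vectors of interest; `f`
  -- respects this as a map of setoids.
  submodularAt-≗ : ∀ {s t m M} → Min₀ s t ≗ m → Max₀ s t ≗ M → SubmodularAt f s t →
                   (f ⟨$⟩ m) + (f ⟨$⟩ M) ≤ (f ⟨$⟩ s) + (f ⟨$⟩ t)
  submodularAt-≗ {s} {t} {m} {M} min≗m max≗M ineq =
    ≤-trans {(f ⟨$⟩ m) + (f ⟨$⟩ M)} {(f ⟨$⟩ Min₀ s t) + (f ⟨$⟩ Max₀ s t)}
            {(f ⟨$⟩ s) + (f ⟨$⟩ t)}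
      (+-mono-≤ {f ⟨$⟩ m} {f ⟨$⟩ Min₀ s t} {f ⟨$⟩ M} {f ⟨$⟩ Max₀ s t}
        (f-≤ (λ e → sym (min≗m e))) (f-≤ (λ e → sym (max≗M e))))
      ineq
    where
    f-≤ : ∀ {a b} → a ≗ b → (f ⟨$⟩ a) ≤ (f ⟨$⟩ b)
    f-≤ {a} {b} a≗b = ≃⇒≤ {f ⟨$⟩ a} {f ⟨$⟩ b} (Func.cong f a≗b)

  -- At `e` the values `i` and `j` conflict, so both operations return zero, which is `s e`;
  -- elsewhere both vectors agree with `s`. Submodularity of this pair thus bounds twice `f` at `s`.
  pairwiseMonotone : (_≟_ : DecidableEquality U) → KSubmodular f → PairwiseMonotone _≟_ f
  pairwiseMonotone _≟_ ksub e s se≡0 i j i≢0 j≢0 i≢j =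
    ≤-shift {F s + F s} {F si + F sj} 0ℝ (marginal _≟_ f i e s + marginal _≟_ f j e s)
      (submodularAt-≗ {si} {sj} {s} {s} min≗ max≗ (ksub si sj)) λ n →
      solve 3 (λ a b c → con 0ℚ :+ (a :+ b) := ((a :- c) :+ (b :- c)) :+ (c :+ c)) refl
        (seq (F si) n) (seq (F sj) n) (seq (F s) n)
    where
    F = f ⟨$⟩_
    si = set _≟_ s e i
    sj = set _≟_ s e j

    min≗ : Min₀ si sj ≗ s
    min≗ e′ with e′ ≟ e
    ... | yes refl = trans (min₀-conflict (i≢0 , j≢0 , i≢j)) (sym se≡0)
    ... | no _ = min₀-idem (s e′)

    max≗ : Max₀ si sj ≗ s
    max≗ e′ with e′ ≟ e
    ... | yes refl = trans (max₀-conflict (i≢0 , j≢0 , i≢j)) (sym se≡0)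
    ... | no _ = max₀-idem (s e′)

-- Sufficiency: induction on conflicts.

module _ {u} {U : Set u} {k : ℕ} (f : RealFunction (suc k) U)
         (sub : SubmodularInEveryOrthant f)
         (_≟_ : DecidableEquality U) (mono : PairwiseMonotone _≟_ f) where

  -- The marginals at `a` with `e` erased, towards `a e` and towards `i`, have a nonnegative sum.
  pairwise-≥ : ∀ e a i → Conflict (a e) i →
               (f ⟨$⟩ set _≟_ a e zero) + (f ⟨$⟩ set _≟_ a e zero) ≤
               (f ⟨$⟩ a) + (f ⟨$⟩ set _≟_ a e i)
  pairwise-≥ e a i (ae≢0 , i≢0 , ae≢i) =
    ≤-shift {0ℝ + (F a′ + F h′)} {((F a′ - F a₀) + (F h′ - F a₀)) + (F a + F h)}
            (F a₀ + F a₀) (F a + F h)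
      (+-mono-≤ {0ℝ} {(F a′ - F a₀) + (F h′ - F a₀)} {F a′ + F h′} {F a + F h}
        (mono e a₀ a₀e≡0 (a e) i ae≢0 i≢0 ae≢i)
        (+-mono-≤ {F a′} {F a} {F h′} {F h}
          (≃⇒≤ {F a′} {F a} (Func.cong f a′≗a)) (≃⇒≤ {F h′} {F h} (Func.cong f h′≗h)))) λ n →
      solve 5 (λ a h a₀ a′ h′ →
          (a₀ :+ a₀) :+ (((a′ :- a₀) :+ (h′ :- a₀)) :+ (a :+ h)) :=
          (a :+ h) :+ (con 0ℚ :+ (a′ :+ h′))) refl
        (seq (F a) n) (seq (F h) n) (seq (F a₀) n) (seq (F a′) n) (seq (F h′) n)
    where
    F = f ⟨$⟩_
    -- Refilling the erased coordinate restores `a` and `h` only pointwise, hence the copies `a′`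
    -- and `h′`.
    a₀ = set _≟_ a e zero
    a′ = set _≟_ a₀ e (a e)
    h = set _≟_ a e i
    h′ = set _≟_ a₀ e i

    a₀e≡0 : a₀ e ≡ zero
    a₀e≡0 with e ≟ e
    ... | yes _ = refl
    ... | no e≢e = ⊥-elim (e≢e refl)

    a′≗a : a′ ≗ a
    a′≗a e′ with e′ ≟ e
    ... | yes refl = refl
    ... | no _ = refl

    h′≗h : h′ ≗ h
    h′≗h e′ with e′ ≟ e
    ... | yes _ = refl
    ... | no _ = refl

  -- `L` may list coordinates without conflict too, so the induction can start from an enumeration
  -- of `U`.
  opposed-≥ : (L : List U) → ∀ a b →
              (∀ e → a e ≡ b e ⊎ Conflict (a e) (b e)) →
              (∀ e → Conflict (a e) (b e) → e ∈ L) →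
              (f ⟨$⟩ Min₀ a b) + (f ⟨$⟩ Min₀ a b) ≤ (f ⟨$⟩ a) + (f ⟨$⟩ b)
  opposed-≥ [] a b opp conflicts∈ =
    -- Without conflicts `a` and `b` agree, so their minimum and maximum coincide.
    submodularAt-≗ f {a} {b} (λ _ → refl)
      (λ e → trans (cong (max₀ (a e)) (sym (a≗b e)))
               (trans (max₀-idem (a e))
                 (trans (sym (min₀-idem (a e))) (cong (min₀ (a e)) (a≗b e)))))
      (submodular-compatible f sub a b (λ e c → ¬Any[] (conflicts∈ e c)))
    where
    a≗b : a ≗ b
    a≗b e with opp e
    ... | inj₁ eq = eq
    ... | inj₂ c = ⊥-elim (¬Any[] (conflicts∈ e c))
  opposed-≥ (e ∷ L) a b opp conflicts∈ with opp e
  ... | inj₁ ae≡be = opposed-≥ L a b opp conflicts∈L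
    where
    conflicts∈L : ∀ e′ → Conflict (a e′) (b e′) → e′ ∈ L
    conflicts∈L e′ c@(_ , _ , a≢b) with conflicts∈ e′ c
    ... | here refl = ⊥-elim (a≢b ae≡be)
    ... | there e′∈L = e′∈L
  ... | inj₂ c =
    ≤-shift {((F a₀ + F a₀) + (F d + F d)) + ((F m + F h) + (F m + F h))}
            {((F a + F h) + (F h + F b)) + ((F a₀ + F d) + (F a₀ + F d))}
            (F m + F m) (F a + F b)
      (+-mono-≤ {(F a₀ + F a₀) + (F d + F d)} {(F a + F h) + (F h + F b)}
                {(F m + F h) + (F m + F h)} {(F a₀ + F d) + (F a₀ + F d)}
        (+-mono-≤ {F a₀ + F a₀} {F a + F h} {F d + F d} {F h + F b}
          (pairwise-≥ e a (b e) c)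
          -- `h` agrees with `b` at `e`, so every remaining conflict lies in the tail.
          (opposed-≥ L h b opp-h conflicts∈L))
        (+-mono-≤ {F m + F h} {F a₀ + F d} {F m + F h} {F a₀ + F d}
          orthant-≥ orthant-≥)) λ n →
      solve 6 (λ a b m h a₀ d →
          (m :+ m) :+ (((a :+ h) :+ (h :+ b)) :+ ((a₀ :+ d) :+ (a₀ :+ d))) :=
          (a :+ b) :+ (((a₀ :+ a₀) :+ (d :+ d)) :+ ((m :+ h) :+ (m :+ h)))) refl
        (seq (F a) n) (seq (F b) n) (seq (F m) n) (seq (F h) n) (seq (F a₀) n) (seq (F d) n)
    where
    F = f ⟨$⟩_
    m = Min₀ a b
    a₀ = set _≟_ a e zero
    h = set _≟_ a e (b e)
    d = Min₀ h b

    opp-h : ∀ e′ → h e′ ≡ b e′ ⊎ Conflict (h e′) (b e′)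
    opp-h e′ with e′ ≟ e
    ... | yes refl = inj₁ refl
    ... | no _ = opp e′

    conflicts∈L : ∀ e′ → Conflict (h e′) (b e′) → e′ ∈ L
    conflicts∈L e′ c′ with e′ ≟ e
    ... | yes refl = ⊥-elim (¬conflict-self c′)
    ... | no e′≢e with conflicts∈ e′ c′
    ...   | here e′≡e = ⊥-elim (e′≢e e′≡e)
    ...   | there e′∈L = e′∈L

    compatible : ∀ e′ → ¬ Conflict (a₀ e′) (d e′)
    compatible e′ with e′ ≟ e
    ... | yes refl = ¬conflict-zeroˡ
    ... | no _ = ¬conflict-min₀ (opp e′)

    min≗ : Min₀ a₀ d ≗ m
    min≗ e′ with e′ ≟ e
    ... | yes refl = sym (min₀-conflict c)
    ... | no _ = min₀-min₀ (opp e′)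

    -- At `e`, `a₀` is zero and `d` equals `b e`; elsewhere `d` is `a` or zero, so the maximum gives
    -- back `a`, which is `h` there.
    max≗ : Max₀ a₀ d ≗ h
    max≗ e′ with e′ ≟ e
    ... | yes refl = trans (max₀-zeroˡ _) (min₀-idem (b e))
    ... | no _ = max₀-min₀ (opp e′)

    orthant-≥ : F m + F h ≤ F a₀ + F d
    orthant-≥ = submodularAt-≗ f {a₀} {d} {m} {h} min≗ max≗
      (submodular-compatible f sub a₀ d compatible)

  kSubmodular : (L : List U) → (∀ e → e ∈ L) → KSubmodular f
  kSubmodular L ∈L s t =
    -- The terms in `s′`, `t′`, `a` and `b` cancel, and so do two of the three copies of `F M` on
    -- the left.
    ≤-shift {((F s′ + F a) + (F t′ + F b)) + ((F m + F M) + (F M + F M))}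
            {((F s + F M) + (F t + F M)) + ((F s′ + F t′) + (F a + F b))}
            (F m + F M) (F s + F t)
      (+-mono-≤ {(F s′ + F a) + (F t′ + F b)} {(F s + F M) + (F t + F M)}
                {(F m + F M) + (F M + F M)} {(F s′ + F t′) + (F a + F b)}
        (+-mono-≤ {F s′ + F a} {F s + F M} {F t′ + F b} {F t + F M}
          (submodular-compatible f sub s M (¬conflict-max₀ˡ ∘ cmp))
          (submodular-compatible f sub t M (¬conflict-max₀ʳ ∘ cmp)))
        (+-mono-≤ {F m + F M} {F s′ + F t′} {F M + F M} {F a + F b}
          (submodularAt-≗ f {s′} {t′} (min₀-min₀-max₀ ∘ cmp) (max₀-min₀-max₀ ∘ cmp)
            (submodular-compatible f sub s′ t′ (¬conflict-min₀-max₀ ∘ cmp)))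
          opposed)) λ n →
      solve 8 (λ s t m M s′ t′ a b →
          (m :+ M) :+ (((s :+ M) :+ (t :+ M)) :+ ((s′ :+ t′) :+ (a :+ b))) :=
          (s :+ t) :+ (((s′ :+ a) :+ (t′ :+ b)) :+ ((m :+ M) :+ (M :+ M)))) refl
        (seq (F s) n) (seq (F t) n) (seq (F m) n) (seq (F M) n)
        (seq (F s′) n) (seq (F t′) n) (seq (F a) n) (seq (F b) n)
    where
    F = f ⟨$⟩_
    m = Min₀ s t
    M = Max₀ s t
    s′ = Min₀ s M
    t′ = Min₀ t M
    a = Max₀ s M
    b = Max₀ t M

    cmp : ∀ e → Comparison (s e) (t e) (m e) (M e)
    cmp e = compare₀ (s e) (t e)

    opposed : F M + F M ≤ F a + F b
    opposed = ≤-trans {F M + F M} {F (Min₀ a b) + F (Min₀ a b)} {F a + F b}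
      (+-mono-≤ {F M} {F (Min₀ a b)} {F M} {F (Min₀ a b)} M≤ M≤)
      (opposed-≥ L a b (max₀-max₀-≡⊎conflict ∘ cmp) (λ e _ → ∈L e))
      where
      M≤ : F M ≤ F (Min₀ a b)
      M≤ = ≃⇒≤ {F M} {F (Min₀ a b)} (Func.cong f (λ e → sym (min₀-max₀-max₀ (cmp e))))

-- Enumeration of `U` and the equivalence.

enumeration : ∀ {u} {U : Set u} → Finite U → ∃ λ (L : List U) → ∀ e → e ∈ L
enumeration (n , U↔Fin) = map from (allFin n) , λ e →
  subst (_∈ map from (allFin n)) (strictlyInverseʳ e) (∈-map⁺ from (∈-allFin (to e)))
  where open Inverse U↔Fin

theorem7 : ∀ {u} (k : ℕ) → 2 ℕ.≤ k →
    (U : Set u) (finite : Finite U) (nonempty : U) →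
    (f : RealFunction k U) → (∀ s → f ⟨$⟩ s ≥ 0ℝ) →
    KSubmodular f ⇔ (SubmodularInEveryOrthant f × PairwiseMonotone (Finite⇒≟ finite) f)
-- The bound `2 ≤ k` rules out zero; a successor provides the nonzero value that `commonValue` falls
-- back on.
theorem7 (suc k) _ U finite _ f _ = mk⇔
  (λ ksub → (λ _ _ a b _ _ → ksub a b) , pairwiseMonotone f (Finite⇒≟ finite) ksub)
  (λ (sub , mono) → let L , ∈L = enumeration finite in
    kSubmodular f sub (Finite⇒≟ finite) mono L ∈L)
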